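{- Let $k\in\mathbb{N}$, let $\mathcal{G}$ be a graph class (with a membership test) all of whose members have at least $k+1$ vertices, and let $\mathcal{U}$ be a finite set of graphs. The answer returned by the algorithm Test-Unavoidable-Structures$(\mathcal{G},\mathcal{U},k)$ (described in the context) is correct, that is: if the algorithm returns a graph, then this graph is an element of $\mathcal{G}^k\setminus \mathrm{super}(\mathcal{U})$; and if the algorithm returns NONE, then $\mathcal{G}^k\subseteq \mathrm{super}(\mathcal{U})$.
   Context: Graphs are non-empty, finite and simple; graph classes are closed under isomorphism. A path-decomposition of $G$ is a sequence of bags $V_1,\dots,V_{n'}\subseteq V(G)$ such that every vertex lies in some bag, both ends of every edge lie together in some bag, and for each vertex the indices of the bags containing it form an interval. Its width is $\max_i|V_i|-1$; path-width $\mathrm{pw}(G)$ is the minimum width. A path-decomposition of width $k$ is smooth if all bags have $k+1$ elements and $|V_i\cap V_{i+1}|=k$ for $1\le i<n'$. The graph associated with $V_i$ is $G_i := G[\bigcup_{1\le j\le i}V_j]-E(G[V_i])$. $\mathcal{G}^k:=\{G\in\mathcal{G}: \mathrm{pw}(G)\le k\}$; $\mathrm{super}(\mathcal{U})$ is the class of all graphs that contain a subgraph isomorphic to some member of $\mathcal{U}$. For a smooth path-decomposition (of width $k$) of $G$ with bags $V_1,\dots,V_{n'}$ and each $i$, we say that $G$ contains the pair $(V_i,G_i)$. A pair $(U,H)$ is good if every $G\in\mathcal{G}^k$ containing it satisfies $G\in\mathrm{super}(\mathcal{U})$. Algorithm Test-Unavoidable-Structures$(\mathcal{G},\mathcal{U},k)$,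 with vertices named $u_1,\dots,u_k,v_1,v_2,\dots$: 1. Set $V_1:=\{u_1,\dots,u_k,v_1\}$ and initialise a queue $Q$ with the single pair $(V_1,(V_1,\emptyset))$, where $(V_1,\emptyset)$ is the edgeless graph on $V_1$. If this pair is good, remove it from $Q$. 2. While $Q$ is not empty: remove a pair $(U,H)$ from $Q$. (a) For each $E'\subseteq\{xy: x,y\in U, x\ne y\}$: if $H+E'\in\mathcal{G}\setminus\mathrm{super}(\mathcal{U})$, return $H+E'$ and stop. (b) Let $i=|V(H)|-k$. For each $u\in U$, set $U':=(U\setminus\{u\})\cup\{v_{i+1}\}$, and for each $Y\subseteq U\setminus\{u\}$ set $H':=H+v_{i+1}+\{uy: y\in Y\}$ (add the new vertex $v_{i+1}$ and the edges $uy$). If $H'\notin\mathrm{super}(\mathcal{U})$ and there exists $G\in\mathcal{G}$ containing $(U',H')$, append $(U',H')$ to $Q$. 3. Return NONE. -}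

module Defs where

open import Level using (Level; 0ℓ; _⊔_) renaming (suc to lsuc)
open import Data.Empty using (⊥)
open import Data.Fin.Base using (Fin; toℕ) renaming (_≤_ to _≤ᶠ_)
open import Data.List.Base
  using (List; []; _∷_; [_]; _++_; map; concat; concatMap; take; filter; length;
         lookup; applyUpTo; deduplicate)
open import Data.List.Extrema.Nat using (max)
open import Data.List.Membership.Propositional using (_∈_)
open import Data.List.Membership.DecPropositional using (_∈?_)
open import Data.List.Membership.Propositional.Properties using (∈-filter⁺; ∈-++⁺ˡ)
open import Data.List.Relation.Binary.BagAndSetEquality using (_∼[_]_; set)
open import Data.List.Relation.Binary.Permutation.Propositional using (_↭_)
open import Data.List.Relation.Binary.Subset.Propositional using (_⊆_)
open import Data.List.Relation.Unary.Any using (Any)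
open import Data.Maybe.Base using (Maybe; just; nothing)
open import Data.Nat.Base using (ℕ; suc; _+_; _∸_; _≤_)
open import Data.Nat.Properties using (_≟_; ≤-trans)
open import Data.Product.Base using (∃-syntax; _×_; _,_)
open import Data.Product.Properties using (≡-dec)
open import Data.Sum.Base using (_⊎_; inj₁; inj₂; swap) renaming (map to map-⊎)
open import Function.Bundles using (_⇔_; mk⇔)
open import Relation.Binary.Core using (Rel)
open import Relation.Binary.Definitions using (Decidable; Symmetric; Irreflexive)
open import Relation.Binary.PropositionalEquality.Core using (_≡_; _≢_; refl; sym)
open import Relation.Nullary.Decidable using (no; _×-dec_; _⊎-dec_; ¬?)
open import Relation.Nullary.Negation.Core using (¬_)
open import Relation.Unary using (Pred)

-- Vertices are natural numbers; since graph classes are closed under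
-- isomorphism, any infinite supply of vertices would do.  Finite sets are lists
-- considered up to _∼[ set ]_, so repetitions do not count.

Vertex : Set
Vertex = ℕ

VSet : Set
VSet = List Vertex

∣_∣ : VSet → ℕ
∣ S ∣ = length (deduplicate _≟_ S)

infixl 7 _∩_
infixl 6 _∖_

_∩_ : VSet → VSet → VSet
S ∩ T = filter (λ x → _∈?_ _≟_ x T) S

_∖_ : VSet → Vertex → VSet
S ∖ u = filter (λ x → ¬? (x ≟ u)) S

-- For duplicate-free lists only: repetitions give repeated subsets.
subsets : ∀ {a} {A : Set a} → List A → List (List A)
subsets []       = [ [] ]
subsets (x ∷ xs) = subsets xs ++ map (x ∷_) (subsets xs)

-- The graph without vertices is a value of this type, which makes the
-- operations below total; it is excluded by NonEmpty.
record Graph : Set₁ where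
  field
    V    : VSet
    Adj  : Rel Vertex 0ℓ
    Adj? : Decidable Adj
    symm : Symmetric Adj
    irr  : Irreflexive _≡_ Adj
    Adjˡ : ∀ {x y} → Adj x y → x ∈ V

open Graph public

NonEmpty : Graph → Set
NonEmpty G = ∃[ x ] x ∈ V G

record _≈_ (G H : Graph) : Set where
  field
    V-≈   : V G ∼[ set ] V H
    Adj-≈ : ∀ {x y} → Adj G x y ⇔ Adj H x y

record _≅_ (G H : Graph) : Set where
  field
    to       : Vertex → Vertex
    from     : Vertex → Vertex
    to-∈     : ∀ {x} → x ∈ V G → to x ∈ V H
    from-∈   : ∀ {y} → y ∈ V H → from y ∈ V G
    from∘to  : ∀ {x} → x ∈ V G → from (to x) ≡ x
    to∘from  : ∀ {y} → y ∈ V H → to (from y) ≡ y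
    Adj-to   : ∀ {x y} → x ∈ V G → y ∈ V G → Adj G x y ⇔ Adj H (to x) (to y)

record _Subgraph_ (S G : Graph) : Set where
  field
    V-⊆   : V S ⊆ V G
    Adj-⊆ : ∀ {x y} → Adj S x y → Adj G x y

edgeless : VSet → Graph
edgeless S = record
  { V    = S
  ; Adj  = λ _ _ → ⊥
  ; Adj? = λ _ _ → no (λ ())
  ; symm = λ ()
  ; irr  = λ _ ()
  ; Adjˡ = λ ()
  }

infixl 8 _⟦_⟧
infixl 6 _-E_ _+v_ _+E_

_⟦_⟧ : Graph → VSet → Graph
G ⟦ S ⟧ = record
  { V    = V G ∩ S
  ; Adj  = λ x y → Adj G x y × x ∈ S × y ∈ S
  ; Adj? = λ x y → Adj? G x y ×-dec (_∈?_ _≟_ x S ×-dec _∈?_ _≟_ y S)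
  ; symm = λ (e , x∈S , y∈S) → symm G e , y∈S , x∈S
  ; irr  = λ x≡y (e , _) → irr G x≡y e
  ; Adjˡ = λ (e , x∈S , _) → ∈-filter⁺ (λ x → _∈?_ _≟_ x S) (Adjˡ G e) x∈S
  }

-- G -E H is G − E(H).
_-E_ : Graph → Graph → Graph
G -E H = record
  { V    = V G
  ; Adj  = λ x y → Adj G x y × ¬ Adj H x y
  ; Adj? = λ x y → Adj? G x y ×-dec ¬? (Adj? H x y)
  ; symm = λ (e , ¬e′) → symm G e , λ e′ → ¬e′ (symm H e′)
  ; irr  = λ x≡y (e , _) → irr G x≡y e
  ; Adjˡ = λ (e , _) → Adjˡ G e
  }

_+v_ : Graph → Vertex → Graph
G +v v = record
  { V    = V G ++ [ v ]
  ; Adj  = Adj G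
  ; Adj? = Adj? G
  ; symm = symm G
  ; irr  = irr G
  ; Adjˡ = λ e → ∈-++⁺ˡ (Adjˡ G e)
  }

EdgeSet : Set
EdgeSet = List (Vertex × Vertex)

-- A pair (x , y) in an edge set stands for the unordered pair xy.
Joins : EdgeSet → Rel Vertex 0ℓ
Joins E x y = (x , y) ∈ E ⊎ (y , x) ∈ E

-- To make _+E_ total, pairs that are not pairs of distinct vertices of G are
-- ignored; no such pairs arise in the algorithm.
_+E_ : Graph → EdgeSet → Graph
G +E E = record
  { V    = V G
  ; Adj  = λ x y → Adj G x y ⊎ (Joins E x y × x ≢ y × x ∈ V G × y ∈ V G)
  ; Adj? = λ x y → Adj? G x y ⊎-dec
             ((_∈E? (x , y) ⊎-dec _∈E? (y , x)) ×-dec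
              (¬? (x ≟ y) ×-dec (_∈?_ _≟_ x (V G) ×-dec _∈?_ _≟_ y (V G))))
  ; symm = map-⊎ (symm G)
             (λ (j , x≢y , x∈V , y∈V) → swap j , (λ y≡x → x≢y (sym y≡x)) , y∈V , x∈V)
  ; irr  = λ { x≡y (inj₁ e) → irr G x≡y e ; x≡y (inj₂ (_ , x≢y , _)) → x≢y x≡y }
  ; Adjˡ = λ { (inj₁ e) → Adjˡ G e ; (inj₂ (_ , _ , x∈V , _)) → x∈V }
  }
  where _∈E? = λ p → _∈?_ (≡-dec _≟_ _≟_) p E

record IsPathDecomposition (G : Graph) (bags : List VSet) : Set where
  field
    bag-⊆    : ∀ i → lookup bags i ⊆ V G
    vertices : ∀ {x} → x ∈ V G → ∃[ i ] x ∈ lookup bags i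
    edges    : ∀ {x y} → Adj G x y → ∃[ i ] x ∈ lookup bags i × y ∈ lookup bags i
    interval : ∀ {x} h i j → h ≤ᶠ i → i ≤ᶠ j →
               x ∈ lookup bags h → x ∈ lookup bags j → x ∈ lookup bags i

width : List VSet → ℕ
width bags = max 0 (map ∣_∣ bags) ∸ 1

record IsPathWidth (G : Graph) (w : ℕ) : Set where
  field
    attained : ∃[ bags ] IsPathDecomposition G bags × width bags ≡ w
    minimal  : ∀ {bags} → IsPathDecomposition G bags → w ≤ width bags

-- pw G ≤ k: a minimum is at most k iff some value is, see pw≤-correct.
infix 4 pw_≤_

pw_≤_ : Graph → ℕ → Set
pw G ≤ k = ∃[ bags ] IsPathDecomposition G bags × width bags ≤ k

pw≤-correct : ∀ {G w k} → IsPathWidth G w → (pw G ≤ k) ⇔ (w ≤ k)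
pw≤-correct {G} {w} {k} isPW = mk⇔
  (λ (_ , pd , wd≤k) → ≤-trans (minimal pd) wd≤k)
  (from attained)
  where
  open IsPathWidth isPW
  from : (∃[ bags ] IsPathDecomposition G bags × width bags ≡ w) →
         w ≤ k → pw G ≤ k
  from (bags , pd , refl) w≤k = bags , pd , w≤k

record IsSmooth (k : ℕ) (G : Graph) (bags : List VSet) : Set where
  field
    isPathDecomposition : IsPathDecomposition G bags
    width≡k  : width bags ≡ k
    bag-size : ∀ i → ∣ lookup bags i ∣ ≡ suc k
    meet     : ∀ i j → toℕ j ≡ suc (toℕ i) → ∣ lookup bags i ∩ lookup bags j ∣ ≡ k

associated : Graph → (bags : List VSet) → Fin (length bags) → Graph
associated G bags i =
  G ⟦ concat (take (suc (toℕ i)) bags) ⟧ -E G ⟦ lookup bags i ⟧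

Pair : Set₁
Pair = VSet × Graph

Contains : ℕ → Graph → Pair → Set
Contains k G (U , H) =
  ∃[ bags ] IsSmooth k G bags ×
  (∃[ i ] U ∼[ set ] lookup bags i × H ≈ associated G bags i)

record GraphClass (ℓ : Level) : Set (lsuc 0ℓ ⊔ lsuc ℓ) where
  field
    Member   : Pred Graph ℓ
    nonEmpty : ∀ {G} → Member G → NonEmpty G
    closed   : ∀ {G H} → G ≅ H → Member G → Member H

open GraphClass public

_^_ : ∀ {ℓ} → GraphClass ℓ → ℕ → Pred Graph ℓ
(𝒢 ^ k) G = Member 𝒢 G × pw G ≤ k

super : List Graph → Pred Graph (lsuc 0ℓ)
super 𝒰 G = ∃[ S ] S Subgraph G × Any (S ≅_) 𝒰

-- The tests of Test-Unavoidable-Structures quantify over graph classes and need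
-- not be computable, so the algorithm is given by its terminating runs: each
-- branch taken carries the outcome of the corresponding test.  The loops may
-- proceed in any order.

data Filtered {a p} {A : Set a} (P : Pred A p) : List A → List A → Set (a ⊔ p) where
  []   : Filtered P [] []
  keep : ∀ {x xs ys} → P x   → Filtered P xs ys → Filtered P (x ∷ xs) (x ∷ ys)
  drop : ∀ {x xs ys} → ¬ P x → Filtered P xs ys → Filtered P (x ∷ xs) ys

-- For a duplicate-free list; the set U of every queued pair (U , H) is one.
allEdges : VSet → EdgeSet
allEdges []       = []
allEdges (x ∷ xs) = map (x ,_) xs ++ allEdges xs

module TestUnavoidableStructures {ℓ} (𝒢 : GraphClass ℓ) (𝒰 : List Graph) (k : ℕ) where

  -- The names u₁, …, uₖ, v₁, v₂, … are the numbers 1, 2, 3, ….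
  u v : ℕ → Vertex
  u j = j
  v i = k + i

  Good : Pred Pair (lsuc 0ℓ ⊔ ℓ)
  Good p = ∀ G → (𝒢 ^ k) G → Contains k G p → super 𝒰 G

  initial : Pair
  initial = V₁ , edgeless V₁
    where V₁ = applyUpTo (λ j → u (suc j)) k ++ [ v 1 ]

  data InitialQueue : List Pair → Set (lsuc 0ℓ ⊔ ℓ) where
    removed : Good initial   → InitialQueue []
    kept    : ¬ Good initial → InitialQueue [ initial ]

  Counterexample : Pred Graph (lsuc 0ℓ ⊔ ℓ)
  Counterexample G = Member 𝒢 G × ¬ super 𝒰 G

  -- w is the vertex u dropped from U; the new edges join w to Y.
  extend : Pair → Vertex → VSet → Pair
  extend (U , H) w Y = (U ∖ w) ++ [ v (suc i) ] , H +v v (suc i) +E map (w ,_) Y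
    where i = ∣ V H ∣ ∸ k

  candidates : Pair → List Pair
  candidates (U , H) =
    concatMap (λ w → map (extend (U , H) w) (subsets (U ∖ w))) U

  Admissible : Pred Pair (lsuc 0ℓ ⊔ ℓ)
  Admissible (U′ , H′) =
    ¬ super 𝒰 H′ × (∃[ G ] Member 𝒢 G × Contains k G (U′ , H′))

  -- Run Q r: started with queue Q, the loop of step 2 ends with answer r, where
  -- nothing stands for NONE.
  data Run : List Pair → Maybe Graph → Set (lsuc 0ℓ ⊔ ℓ) where
    none   : Run [] nothing
    return : ∀ {U H Q E′} → E′ ∈ subsets (allEdges U) →
             Counterexample (H +E E′) →
             Run ((U , H) ∷ Q) (just (H +E E′))
    next   : ∀ {U H Q ps new r} →
             (∀ {E′} → E′ ∈ subsets (allEdges U) → ¬ Counterexample (H +E E′)) →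
             ps ↭ candidates (U , H) → Filtered Admissible ps new →
             Run (Q ++ new) r →
             Run ((U , H) ∷ Q) r

  Returns : Maybe Graph → Set (lsuc 0ℓ ⊔ ℓ)
  Returns r = ∃[ Q ] InitialQueue Q × Run Q r

{-# OPTIONS --safe #-}

-- Soundness: the successive sets that led to a queued pair (U , H) form, with U as
-- last bag, a path-decomposition of H of width at most k, and adding edges
-- inside U does not spoil it.
--
-- Completeness: number the vertices of G in the order in which they enter the bags
-- of a path-decomposition of width at most k.  Then, for each m, at most k of the
-- first m vertices have a later neighbour.  Hence, starting from the first k + 1 vertices,
-- one can let each next vertex replace one without later neighbours, which gives a
-- smooth path-decomposition whose pairs are, name by name, pairs the algorithm
-- creates.  If G were not in super 𝒰, all of them would pass through the queue, and
-- the last one would make the algorithm return G.  Since super 𝒰 is decidable, the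
-- argument by contradiction is constructive.

module Submission where

open import Defs
open import Level using (Level)
open import Data.Empty using (⊥)
open import Data.Fin.Base using (Fin; zero; suc; toℕ; fromℕ<)
open import Data.Fin.Properties using (toℕ-fromℕ<; toℕ<n)
open import Data.List.Base
  using (List; []; _∷_; [_]; _++_; map; concat; concatMap; take; filter; length;
         lookup; applyUpTo; deduplicate)
open import Data.List.Extrema.Nat using (max≤v⁺; v≤max⁺; xs≤max)
open import Data.List.Membership.DecPropositional using (_∈?_)
open import Data.List.Membership.Propositional using (_∈_; _∉_; lose; find)
open import Data.List.Membership.Propositional.Properties
  using (∈-++⁺ˡ; ∈-++⁺ʳ; ∈-++⁻; ∈-map⁺; ∈-map⁻; ∈-filter⁺; ∈-filter⁻; ∈-lookup;
         ∈-deduplicate⁺; ∈-deduplicate⁻; ∈-applyUpTo⁺; ∈-applyUpTo⁻;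
         ∈-concat⁺′; ∈-concat⁻′; ∈-concatMap⁺; ∈-concatMap⁻)
open import Data.List.Properties
  using (filter-notAll; length-deduplicate; length-++; length-map;
         length-applyUpTo; lookup-applyUpTo; applyUpTo-∷ʳ)
open import Data.List.Relation.Binary.BagAndSetEquality using (_∼[_]_; set)
open import Data.List.Relation.Binary.Permutation.Propositional using (_↭_; ↭-sym; ↭⇒↭ₛ)
open import Data.List.Relation.Binary.Permutation.Propositional.Properties using (∈-resp-↭)
open import Data.List.Relation.Binary.Permutation.Setoid.Properties using (Unique-resp-↭)
open import Data.List.Relation.Binary.Subset.Propositional using (_⊆_)
open import Data.List.Relation.Unary.All as All using (All; []; _∷_)
open import Data.List.Relation.Unary.All.Properties using ()
  renaming (map⁺ to All-map⁺; map⁻ to All-map⁻; ++⁺ to All-++⁺; applyUpTo⁺₁ to All-applyUpTo⁺)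
open import Data.List.Relation.Unary.AllPairs using (AllPairs; []; _∷_)
open import Data.List.Relation.Unary.Any as Any using (Any; here; there)
open import Data.List.Relation.Unary.Sorted.TotalOrder.Properties using (Sorted⇒AllPairs)
open import Data.List.Relation.Unary.Unique.DecPropositional.Properties using (deduplicate-!)
open import Data.List.Relation.Unary.Unique.Propositional using (Unique)
open import Data.List.Relation.Unary.Unique.Propositional.Properties
  using (applyUpTo⁺₁; filter⁺; ++⁺)
import Data.List.Sort as Sort
open import Data.Maybe.Base using (just; nothing)
open import Data.Nat.Base using (ℕ; zero; suc; pred; _+_; _∸_; _≤_; _<_; z≤n; s≤s; s<s)
open import Data.Nat.Properties
open import Data.Product.Base using (∃-syntax; _×_; _,_; proj₁; proj₂)
open import Data.Sum.Base using (_⊎_; inj₁; inj₂) renaming (map to map-⊎)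
open import Function.Base using (_∘_; id)
open import Function.Bundles using (_⇔_; mk⇔; Equivalence)
open import Relation.Binary.Bundles using (module DecTotalOrder)
import Relation.Binary.Construct.On as On
open import Relation.Binary.Core using (Rel)
open import Relation.Binary.Definitions using (tri<; tri≈; tri>)
open import Relation.Binary.PropositionalEquality
  using (_≡_; _≢_; refl; sym; trans; cong; subst; setoid)
open import Relation.Nullary.Decidable
  using (Dec; yes; no; map′; _×-dec_; _→-dec_; ¬?; decidable-stable)
open import Relation.Nullary.Negation.Core using (¬_; contradiction)
open import Relation.Unary using (Pred; Decidable)

open Equivalence using (to; from)


-- Cardinality of finite sets given as lists.

∈-∖⁺ : ∀ {S w x} → x ∈ S → x ≢ w → x ∈ S ∖ w
∈-∖⁺ {w = w} = ∈-filter⁺ (λ x → ¬? (x ≟ w))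

∈-∖⁻ : ∀ {S w x} → x ∈ S ∖ w → x ∈ S × x ≢ w
∈-∖⁻ {S} {w} = ∈-filter⁻ (λ x → ¬? (x ≟ w)) {xs = S}

length-∖ : ∀ {S w} → w ∈ S → length (S ∖ w) < length S
length-∖ {S} {w} w∈S =
  filter-notAll (λ x → ¬? (x ≟ w)) S (Any.map (λ w≡x x≢w → x≢w (sym w≡x)) w∈S)

-- Pigeonhole by induction on `S`: striking the head of `S` from `T` shortens `T`, and the tail of
-- `S` survives because it avoids the head.
Unique-⊆⇒length≤ : ∀ {S T : VSet} → Unique S → S ⊆ T → length S ≤ length T
Unique-⊆⇒length≤ [] _ = z≤n
Unique-⊆⇒length≤ (x∉S ∷ S!) S⊆T = ≤-<-trans
  (Unique-⊆⇒length≤ S! (λ y∈S → ∈-∖⁺ (S⊆T (there y∈S)) (All.lookup x∉S y∈S ∘ sym)))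
  (length-∖ (S⊆T (here refl)))

length-∖-Unique : ∀ {S w} → Unique S → w ∈ S → suc (length (S ∖ w)) ≡ length S
length-∖-Unique {S} {w} S! w∈S = ≤-antisym (length-∖ w∈S) (Unique-⊆⇒length≤ S! S⊆)
  where
  S⊆ : S ⊆ w ∷ S ∖ w
  S⊆ {x} x∈S with x ≟ w
  ... | yes x≡w = here x≡w
  ... | no  x≢w = there (∈-∖⁺ x∈S x≢w)

∣∣-mono : ∀ {S T} → S ⊆ T → ∣ S ∣ ≤ ∣ T ∣
∣∣-mono {S} S⊆T = Unique-⊆⇒length≤ (deduplicate-! _≟_ S)
  (∈-deduplicate⁺ _≟_ ∘ S⊆T ∘ ∈-deduplicate⁻ _≟_ S)

∣∣-cong : ∀ {S T} → S ∼[ set ] T → ∣ S ∣ ≡ ∣ T ∣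
∣∣-cong S∼T = ≤-antisym (∣∣-mono (to S∼T)) (∣∣-mono (from S∼T))

∣∣≤length : ∀ S → ∣ S ∣ ≤ length S
∣∣≤length = length-deduplicate _≟_

∣∣-Unique : ∀ {S} → Unique S → ∣ S ∣ ≡ length S
∣∣-Unique {S} S! =
  ≤-antisym (∣∣≤length S) (Unique-⊆⇒length≤ S! (∈-deduplicate⁺ _≟_))

-- Renaming, isomorphism and embedding of graphs.

-- Serves both to renumber a graph and to form the image of an embedding. Adjacency is confined to
-- `S`, since `f` may also send numbers outside `S` to vertices of `G`.
pullback : (Vertex → Vertex) → VSet → Graph → Graph
pullback f S G = record
  { V    = S
  ; Adj  = λ x y → Adj G (f x) (f y) × x ∈ S × y ∈ S
  ; Adj? = λ x y → Adj? G (f x) (f y) ×-dec (_∈?_ _≟_ x S ×-dec _∈?_ _≟_ y S)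
  ; symm = λ (e , x∈S , y∈S) → symm G e , y∈S , x∈S
  ; irr  = λ x≡y (e , _) → irr G (cong f x≡y) e
  ; Adjˡ = λ (_ , x∈S , _) → x∈S
  }

InjectiveOn : VSet → (Vertex → Vertex) → Set
InjectiveOn S f = ∀ {x y} → x ∈ S → y ∈ S → f x ≡ f y → x ≡ y

-- The value 0 is reached only outside the image of `S`.
inverse : (Vertex → Vertex) → VSet → Vertex → Vertex
inverse f []      y = 0
inverse f (x ∷ S) y with f x ≟ y
... | yes _ = x
... | no  _ = inverse f S y

inverse-image : ∀ f {S y} → y ∈ map f S → inverse f S y ∈ S × f (inverse f S y) ≡ y
inverse-image f {x ∷ S} {y} y∈ with f x ≟ y | y∈
... | yes fx≡y | _         = here refl , fx≡y
... | no  fx≢y | here y≡fx = contradiction (sym y≡fx) fx≢y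
... | no  _    | there y∈′ = let x∈ , eq = inverse-image f y∈′ in there x∈ , eq

pullback-≅ : ∀ {f S G} → InjectiveOn S f → map f S ∼[ set ] V G → pullback f S G ≅ G
pullback-≅ {f} {S} f-inj f[S]∼V = record
  { to      = f
  ; from    = inverse f S
  ; to-∈    = λ x∈S → to f[S]∼V (∈-map⁺ f x∈S)
  ; from-∈  = λ y∈V → proj₁ (inverse-image f (from f[S]∼V y∈V))
  ; from∘to = λ x∈S → let x′∈S , eq = inverse-image f (∈-map⁺ f x∈S) in f-inj x′∈S x∈S eq
  ; to∘from = λ y∈V → proj₂ (inverse-image f (from f[S]∼V y∈V))
  ; Adj-to  = λ x∈S y∈S → mk⇔ proj₁ (_, x∈S , y∈S)
  }

≅-sym : ∀ {G H} → G ≅ H → H ≅ G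
≅-sym {G} {H} φ = record
  { to      = φ.from
  ; from    = φ.to
  ; to-∈    = φ.from-∈
  ; from-∈  = φ.to-∈
  ; from∘to = φ.to∘from
  ; to∘from = φ.from∘to
  ; Adj-to  = λ {x} {y} x∈ y∈ → mk⇔
      (λ e → from (φ.Adj-to (φ.from-∈ x∈) (φ.from-∈ y∈))
        (subst (λ z → Adj H z _) (sym (φ.to∘from x∈))
          (subst (Adj H x) (sym (φ.to∘from y∈)) e)))
      (λ e → subst (λ z → Adj H z y) (φ.to∘from x∈)
        (subst (Adj H _) (φ.to∘from y∈)
          (to (φ.Adj-to (φ.from-∈ x∈) (φ.from-∈ y∈)) e)))
  }
  where module φ = _≅_ φ

≈⇒≅ : ∀ {G H} → G ≈ H → G ≅ H
≈⇒≅ G≈H = record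
  { to      = id
  ; from    = id
  ; to-∈    = to V-≈
  ; from-∈  = from V-≈
  ; from∘to = λ _ → refl
  ; to∘from = λ _ → refl
  ; Adj-to  = λ _ _ → Adj-≈
  }
  where open _≈_ G≈H

-- Replaces the quantification over subgraphs in `super` by a map that matters only on finitely many
-- vertices, so that its existence can be decided by search.
record Embedding (S G : Graph) : Set where
  field
    fun  : Vertex → Vertex
    mem  : ∀ {x} → x ∈ V S → fun x ∈ V G
    inj  : InjectiveOn (V S) fun
    edge : ∀ {x y} → Adj S x y → Adj G (fun x) (fun y)

Embedding-trans : ∀ {F G H} → Embedding F G → Embedding G H → Embedding F H
Embedding-trans φ ψ = record
  { fun  = ψ.fun ∘ φ.fun
  ; mem  = ψ.mem ∘ φ.mem
  ; inj  = λ x∈ y∈ → φ.inj x∈ y∈ ∘ ψ.inj (φ.mem x∈) (φ.mem y∈)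
  ; edge = ψ.edge ∘ φ.edge
  }
  where module φ = Embedding φ ; module ψ = Embedding ψ

Adjʳ : ∀ G {x y} → Adj G x y → y ∈ V G
Adjʳ G e = Adjˡ G (symm G e)

Subgraph⇒Embedding : ∀ {S G} → S Subgraph G → Embedding S G
Subgraph⇒Embedding S⊆G = record { fun = id ; mem = V-⊆ ; inj = λ _ _ → id ; edge = Adj-⊆ }
  where open _Subgraph_ S⊆G

≅⇒Embedding : ∀ {G H} → G ≅ H → Embedding G H
≅⇒Embedding {G} φ = record
  { fun  = φ.to
  ; mem  = φ.to-∈
  ; inj  = λ x∈ y∈ eq → trans (sym (φ.from∘to x∈)) (trans (cong φ.from eq) (φ.from∘to y∈))
  ; edge = λ e → to (φ.Adj-to (Adjˡ G e) (Adjʳ G e)) e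
  }
  where module φ = _≅_ φ

super⇒Embedding : ∀ {𝒰 G} → super 𝒰 G → Any (λ U → Embedding U G) 𝒰
super⇒Embedding (_ , S⊆G , S≅𝒰) =
  Any.map (λ S≅U → Embedding-trans (≅⇒Embedding (≅-sym S≅U)) (Subgraph⇒Embedding S⊆G)) S≅𝒰

-- The image of an embedding is the pullback along the inverse of the embedding.
image : ∀ {U G} → Embedding U G → ∃[ S ] S Subgraph G × S ≅ U
image {U} {G} φ = S , S⊆G , pullback-≅ inv-inj inv-surj
  where
  open Embedding φ
  inv = inverse fun (V U)
  S = pullback inv (map fun (V U)) U
  inv-fun : ∀ {y} → y ∈ map fun (V U) → fun (inv y) ≡ y
  inv-fun y∈ = proj₂ (inverse-image fun y∈)
  S⊆G : S Subgraph G
  S⊆G = record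
    { V-⊆   = λ y∈ → let _ , x∈U , y≡ = ∈-map⁻ fun y∈ in
                subst (_∈ V G) (sym y≡) (mem x∈U)
    ; Adj-⊆ = λ {x} {y} (e , x∈ , y∈) →
                subst (λ z → Adj G z y) (inv-fun x∈)
                  (subst (Adj G _) (inv-fun y∈) (edge e))
    }
  inv-inj : InjectiveOn (map fun (V U)) inv
  inv-inj x∈ y∈ eq = trans (sym (inv-fun x∈)) (trans (cong fun eq) (inv-fun y∈))
  inv-surj : map inv (map fun (V U)) ∼[ set ] V U
  inv-surj = mk⇔
    (λ z∈ → let _ , y∈ , z≡ = ∈-map⁻ inv z∈ in
       subst (_∈ V U) (sym z≡) (proj₁ (inverse-image fun y∈)))
    (λ x∈U → let x′∈U , eq = inverse-image fun (∈-map⁺ fun x∈U) in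
       subst (_∈ map inv (map fun (V U))) (inj x′∈U x∈U eq) (∈-map⁺ inv (∈-map⁺ fun x∈U)))

Embedding⇒super : ∀ {𝒰 G} → Any (λ U → Embedding U G) 𝒰 → super 𝒰 G
Embedding⇒super (here φ)   = let S , S⊆G , S≅U = image φ in S , S⊆G , here S≅U
Embedding⇒super (there φs) = let S , S⊆G , S≅𝒰 = Embedding⇒super φs in S , S⊆G , there S≅𝒰

super-Embedding : ∀ {𝒰 G H} → Embedding G H → super 𝒰 G → super 𝒰 H
super-Embedding φ = Embedding⇒super ∘ Any.map (λ ψ → Embedding-trans ψ φ) ∘ super⇒Embedding

-- Decidability of `super` by exhaustive search.

override : Vertex → Vertex → (Vertex → Vertex) → Vertex → Vertex
override x y f z with z ≟ x
... | yes _ = y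
... | no  _ = f z

-- Contains a representative of every map from `S` to `T`; outside `S` each of them is the identity.
functions : VSet → VSet → List (Vertex → Vertex)
functions []      T = [ id ]
functions (x ∷ S) T = concatMap (λ f → map (λ y → override x y f) T) (functions S T)

functions-complete : ∀ f S T → (∀ {x} → x ∈ S → f x ∈ T) →
                     ∃[ g ] g ∈ functions S T × (∀ {x} → x ∈ S → g x ≡ f x)
functions-complete f []      T _    = id , here refl , λ ()
functions-complete f (x ∷ S) T f[S]⊆T
  with g , g∈ , g≗f ← functions-complete f S T (f[S]⊆T ∘ there)
  = override x (f x) g
  , ∈-concatMap⁺ (λ g → map (λ y → override x y g) T)
      (lose g∈ (∈-map⁺ (λ y → override x y g) (f[S]⊆T (here refl))))
  , agree
  where
  agree : ∀ {z} → z ∈ x ∷ S → override x (f x) g z ≡ f z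
  agree {z} z∈ with z ≟ x | z∈
  ... | yes z≡x | _         = cong f (sym z≡x)
  ... | no  z≢x | here z≡x  = contradiction z≡x z≢x
  ... | no  _   | there z∈S = g≗f z∈S

embedding? : ∀ S G → Dec (Embedding S G)
embedding? S G = map′ sound complete (Any.any? check? (functions (V S) (V G)))
  where
  Check : (Vertex → Vertex) → Set
  Check f =
    All (λ x → f x ∈ V G ×
      All (λ y → (f x ≡ f y → x ≡ y) × (Adj S x y → Adj G (f x) (f y))) (V S)) (V S)

  check? : Decidable Check
  check? f = All.all? (λ x → _∈?_ _≟_ (f x) (V G) ×-dec
    All.all? (λ y → (f x ≟ f y →-dec x ≟ y) ×-dec (Adj? S x y →-dec Adj? G (f x) (f y)))
      (V S)) (V S)

  sound : Any Check (functions (V S) (V G)) → Embedding S G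
  sound any with f , c ← Any.satisfied any = record
    { fun  = f
    ; mem  = λ x∈ → proj₁ (All.lookup c x∈)
    ; inj  = λ x∈ y∈ → proj₁ (All.lookup (proj₂ (All.lookup c x∈)) y∈)
    ; edge = λ e → proj₂ (All.lookup (proj₂ (All.lookup c (Adjˡ S e))) (Adjʳ S e)) e
    }

  complete : Embedding S G → Any Check (functions (V S) (V G))
  complete φ =
    let g , g∈ , g≗f = functions-complete fun (V S) (V G) mem in
    lose g∈ (All.tabulate λ x∈ →
      subst (_∈ V G) (sym (g≗f x∈)) (mem x∈) , All.tabulate λ y∈ →
        (λ eq → inj x∈ y∈ (trans (sym (g≗f x∈)) (trans eq (g≗f y∈)))) ,
        (λ e → subst (λ z → Adj G z _) (sym (g≗f x∈))
                 (subst (Adj G _) (sym (g≗f y∈)) (edge e))))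
    where open Embedding φ

super? : ∀ 𝒰 → Decidable (super 𝒰)
super? 𝒰 G = map′ Embedding⇒super super⇒Embedding (Any.any? (λ U → embedding? U G) 𝒰)

-- The vertex names 1, ..., n; widths; the sets that the algorithm enumerates.

range : ℕ → VSet
range = applyUpTo suc

∈-range⁻ : ∀ {n x} → x ∈ range n → x ≤ n
∈-range⁻ x∈ with _ , i<n , refl ← ∈-applyUpTo⁻ suc x∈ = i<n

range-Unique : ∀ n → Unique (range n)
range-Unique n = applyUpTo⁺₁ suc n (λ i<j _ i≡j → <⇒≢ i<j (suc-injective i≡j))

∣range∣ : ∀ n → ∣ range n ∣ ≡ n
∣range∣ n = trans (∣∣-Unique (range-Unique n)) (length-applyUpTo suc n)

range-∷ʳ : ∀ n → range n ++ [ suc n ] ≡ range (suc n)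
range-∷ʳ = applyUpTo-∷ʳ suc

∈-∷ʳ : ∀ S {y : Vertex} → y ∈ S ++ [ y ]
∈-∷ʳ S = ∈-++⁺ʳ S (here refl)

∈-∷ʳ⁻ : ∀ S {x y : Vertex} → x ∈ S ++ [ y ] → x ∈ S ⊎ x ≡ y
∈-∷ʳ⁻ S x∈ with ∈-++⁻ S x∈
... | inj₁ x∈S        = inj₁ x∈S
... | inj₂ (here x≡y) = inj₂ x≡y

length-exchange : ∀ {S w n} v → w ∈ S → length S ≤ n → length (S ∖ w ++ [ v ]) ≤ n
length-exchange {S} {w} {n} v w∈S S≤n = begin
  length (S ∖ w ++ [ v ]) ≡⟨ length-++ (S ∖ w) ⟩
  length (S ∖ w) + 1      ≡⟨ +-comm (length (S ∖ w)) 1 ⟩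
  suc (length (S ∖ w))    ≤⟨ length-∖ w∈S ⟩
  length S                ≤⟨ S≤n ⟩
  n                       ∎
  where open ≤-Reasoning

width-≤ : ∀ {k bags} → All (λ b → ∣ b ∣ ≤ suc k) bags → width bags ≤ k
width-≤ bags≤ = ∸-monoˡ-≤ 1 (max≤v⁺ z≤n (All-map⁺ bags≤))

∈-subsets⁻ : ∀ {a} {A : Set a} {ys} (xs : List A) → ys ∈ subsets xs → ys ⊆ xs
∈-subsets⁻ []       (here refl) ()
∈-subsets⁻ (x ∷ xs) ys∈ with ∈-++⁻ (subsets xs) ys∈
... | inj₁ ys∈′ = there ∘ ∈-subsets⁻ xs ys∈′
... | inj₂ ys∈′ with ∈-map⁻ (x ∷_) ys∈′
...   | _ , zs∈ , refl = λ { (here y≡x) → here y≡x ; (there y∈zs) → there (∈-subsets⁻ xs zs∈ y∈zs) }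

∈-allEdges⁻ : ∀ {x y} S → (x , y) ∈ allEdges S → x ∈ S × y ∈ S
∈-allEdges⁻ (z ∷ S) e with ∈-++⁻ (map (z ,_) S) e
... | inj₂ e′ = let x∈ , y∈ = ∈-allEdges⁻ S e′ in there x∈ , there y∈
... | inj₁ e′ with _ , y∈ , refl ← ∈-map⁻ (z ,_) e′ = here refl , there y∈

-- Path-decompositions after adding edges or a vertex.

+E-isPathDecomposition : ∀ {H bags E} i → IsPathDecomposition H bags →
                         (∀ {x y} → (x , y) ∈ E → x ∈ lookup bags i × y ∈ lookup bags i) →
                         IsPathDecomposition (H +E E) bags
+E-isPathDecomposition i pd E⊆bag = record
  { bag-⊆    = bag-⊆
  ; vertices = vertices
  ; edges    = λ
      { (inj₁ e)             → edges e
      ; (inj₂ (inj₁ xy , _)) → i , E⊆bag xy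
      ; (inj₂ (inj₂ yx , _)) → let y∈ , x∈ = E⊆bag yx in i , x∈ , y∈
      }
  ; interval = interval
  }
  where open IsPathDecomposition pd

module _ {H : Graph} {U : VSet} {bags : List VSet} (pd : IsPathDecomposition H (U ∷ bags)) where
  open IsPathDecomposition pd

  -- The fresh `v` occurs in the new bag only, and all else in that bag comes from `U`, the bag next
  -- to it, so intervals stay intervals.
  +v-isPathDecomposition : ∀ {v w} → v ∉ V H →
                           IsPathDecomposition (H +v v) ((U ∖ w ++ [ v ]) ∷ U ∷ bags)
  +v-isPathDecomposition {v} {w} v∉V = record
    { bag-⊆    = bag-⊆′
    ; vertices = vertices′
    ; edges    = λ e → let i , x∈ , y∈ = edges e in suc i , x∈ , y∈
    ; interval = interval′
    }
    where
    U′ = U ∖ w ++ [ v ]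

    bag-⊆′ : ∀ i → lookup (U′ ∷ U ∷ bags) i ⊆ V (H +v v)
    bag-⊆′ (suc i) x∈ = ∈-++⁺ˡ (bag-⊆ i x∈)
    bag-⊆′ zero    x∈ with ∈-∷ʳ⁻ (U ∖ w) x∈
    ... | inj₁ x∈U∖w = ∈-++⁺ˡ (bag-⊆ zero (proj₁ (∈-∖⁻ {U} x∈U∖w)))
    ... | inj₂ refl  = ∈-∷ʳ (V H)

    vertices′ : ∀ {x} → x ∈ V (H +v v) → ∃[ i ] x ∈ lookup (U′ ∷ U ∷ bags) i
    vertices′ x∈ with ∈-∷ʳ⁻ (V H) x∈
    ... | inj₁ x∈V  = let i , x∈i = vertices x∈V in suc i , x∈i
    ... | inj₂ refl = zero , ∈-∷ʳ (U ∖ w)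

    interval′ : ∀ {x} h i j → toℕ h ≤ toℕ i → toℕ i ≤ toℕ j →
                x ∈ lookup (U′ ∷ U ∷ bags) h → x ∈ lookup (U′ ∷ U ∷ bags) j →
                x ∈ lookup (U′ ∷ U ∷ bags) i
    interval′ zero    zero    j       _         _         x∈h _   = x∈h
    interval′ (suc h) (suc i) (suc j) (s≤s h≤i) (s≤s i≤j) x∈h x∈j = interval h i j h≤i i≤j x∈h x∈j
    interval′ zero    (suc i) (suc j) _         (s≤s i≤j) x∈h x∈j with ∈-∷ʳ⁻ (U ∖ w) x∈h
    ... | inj₁ x∈U∖w = interval zero i j z≤n i≤j (proj₁ (∈-∖⁻ {U} x∈U∖w)) x∈j
    ... | inj₂ refl  = contradiction (bag-⊆ j x∈j) v∉V

edgeless-isPathDecomposition : ∀ S → IsPathDecomposition (edgeless S) [ S ]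
edgeless-isPathDecomposition S = record
  { bag-⊆    = λ { zero → id }
  ; vertices = λ x∈S → zero , x∈S
  ; edges    = λ ()
  ; interval = λ { h zero j _ _ _ x∈j → x∈S j x∈j }
  }
  where
  x∈S : ∀ j {x} → x ∈ lookup [ S ] j → x ∈ S
  x∈S zero x∈ = x∈

-- Soundness of a returned graph.

Filtered-⊆ : ∀ {a p} {A : Set a} {P : A → Set p} {xs ys : List A} → Filtered P xs ys → ys ⊆ xs
Filtered-⊆ (keep _ f) (here y≡)  = here y≡
Filtered-⊆ (keep _ f) (there y∈) = there (Filtered-⊆ f y∈)
Filtered-⊆ (drop _ f) y∈         = there (Filtered-⊆ f y∈)

module Soundness {ℓ} (𝒢 : GraphClass ℓ) (𝒰 : List Graph) (k : ℕ) where
  open TestUnavoidableStructures 𝒢 𝒰 k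

  -- The bags are listed in reverse order of their construction.
  record Invariant (p : Pair) : Set where
    constructor inv
    field
      earlier       : List VSet
      decomposition : IsPathDecomposition (proj₂ p) (proj₁ p ∷ earlier)
      small         : All (λ b → length b ≤ suc k) (proj₁ p ∷ earlier)
      size          : ℕ
      k≤size        : k ≤ size
      names         : V (proj₂ p) ≡ range size

  initial-names : range k ++ [ v 1 ] ≡ range (suc k)
  initial-names = trans (cong (λ n → range k ++ [ n ]) (+-comm k 1)) (range-∷ʳ k)

  initial-Invariant : Invariant initial
  initial-Invariant = inv [] (edgeless-isPathDecomposition _)
    (≤-reflexive (trans (cong length initial-names) (length-applyUpTo suc (suc k))) ∷ [])
    (suc k) (n≤1+n k) initial-names

  -- The offset `k` in `v` undoes the subtraction of `k`, so the name that the algorithm picks is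
  -- the successor of the names in use.
  v-fresh : ∀ {n m} → k ≤ n → ∣ range n ∣ ≡ m → v (suc (m ∸ k)) ≡ suc n
  v-fresh {n} k≤n refl rewrite ∣range∣ n = trans (+-suc k (n ∸ k)) (cong suc (m+[n∸m]≡n k≤n))

  extend-Invariant : ∀ {U H w Y} → w ∈ U → Y ∈ subsets (U ∖ w) →
                     Invariant (U , H) → Invariant (extend (U , H) w Y)
  extend-Invariant {U} {H} {w} {Y} w∈U Y∈ (inv bags pd (U≤ ∷ bags≤) n k≤n V≡) = inv (U ∷ bags)
    -- The new edges start at `w`, which has just left; both of their ends lie in the previous bag
    -- `U`, now at index one.
    (+E-isPathDecomposition (suc zero) (+v-isPathDecomposition pd v∉V) new-edge)
    (length-exchange (v (suc (∣ V H ∣ ∸ k))) w∈U U≤ ∷ U≤ ∷ bags≤)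
    (suc n) (m≤n⇒m≤1+n k≤n)
    (trans (trans (cong (_++ _) V≡) (cong (λ m → range n ++ [ m ]) v≡)) (range-∷ʳ n))
    where
    v≡ : v (suc (∣ V H ∣ ∸ k)) ≡ suc n
    v≡ = v-fresh k≤n (cong ∣_∣ (sym V≡))
    v∉V : v (suc (∣ V H ∣ ∸ k)) ∉ V H
    v∉V v∈V = 1+n≰n (≤-trans (≤-reflexive (sym v≡)) (∈-range⁻ (subst (_ ∈_) V≡ v∈V)))
    new-edge : ∀ {x y} → (x , y) ∈ map (w ,_) Y → x ∈ U × y ∈ U
    new-edge e with y , y∈Y , refl ← ∈-map⁻ (w ,_) e =
      w∈U , proj₁ (∈-∖⁻ {U} (∈-subsets⁻ (U ∖ w) Y∈ y∈Y))

  ∈-candidates⁻ : ∀ p {q} → q ∈ candidates p →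
                  ∃[ w ] ∃[ Y ] w ∈ proj₁ p × Y ∈ subsets (proj₁ p ∖ w) × q ≡ extend p w Y
  ∈-candidates⁻ p@(U , H) q∈
    with w , w∈U , q∈w ← find (∈-concatMap⁻ (λ w → map (extend p w) (subsets (U ∖ w))) {xs = U} q∈)
    with Y , Y∈ , q≡ ← ∈-map⁻ (extend p w) q∈w
    = w , Y , w∈U , Y∈ , q≡

  -- The test in `return` already settles membership in the class and avoidance of `𝒰`. The bound on
  -- the path-width comes from the invariant, which every candidate inherits.
  run-sound : ∀ {Q G} → All Invariant Q → Run Q (just G) → (𝒢 ^ k) G × ¬ super 𝒰 G
  run-sound (inv bags pd small _ _ _ ∷ _) (return {U = U} E′∈ (G∈𝒢 , G∉super)) =
    (G∈𝒢 , U ∷ bags ,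
      -- The chosen edges lie inside `U`, the bag at index zero.
      +E-isPathDecomposition zero pd (∈-allEdges⁻ U ∘ ∈-subsets⁻ (allEdges U) E′∈) ,
      width-≤ {bags = U ∷ bags} (All.map (λ {b} → ≤-trans (∣∣≤length b)) small)) ,
    G∉super
  run-sound {p ∷ _} (I ∷ Is) (next _ ps↭ filtered run) = run-sound (All-++⁺ Is (All.tabulate new)) run
    where
    new : ∀ {q} → q ∈ _ → Invariant q
    new q∈ with _ , _ , w∈U , Y∈ , refl ← ∈-candidates⁻ p (∈-resp-↭ ps↭ (Filtered-⊆ filtered q∈))
      = extend-Invariant w∈U Y∈ I

  sound : ∀ {G} → Returns (just G) → (𝒢 ^ k) G × ¬ super 𝒰 G
  sound (_ , kept _ , run) = run-sound (initial-Invariant ∷ []) run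

-- Numbering the vertices by their first bag.

map-Unique : ∀ {f S} → InjectiveOn S f → Unique S → Unique (map f S)
map-Unique inj []         = []
map-Unique inj (x∉S ∷ S!) =
  All-map⁺ (All.tabulate λ y∈S fx≡fy →
    All.lookup x∉S y∈S (inj (here refl) (there y∈S) fx≡fy)) ∷
  map-Unique (λ x∈ y∈ → inj (there x∈) (there y∈)) S!

-- Junk value 0 beyond the end of the list.
at : VSet → ℕ → Vertex
at []      _       = 0
at (x ∷ _) zero    = x
at (_ ∷ S) (suc i) = at S i

at-∈ : ∀ S {i} → i < length S → at S i ∈ S
at-∈ (x ∷ S) {zero}  _         = here refl
at-∈ (x ∷ S) {suc i} (s≤s i<n) = there (at-∈ S i<n)

∈-at : ∀ {S x} → x ∈ S → ∃[ i ] i < length S × at S i ≡ x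
∈-at (here refl) = zero , s≤s z≤n , refl
∈-at (there x∈S) = let i , i<n , eq = ∈-at x∈S in suc i , s≤s i<n , eq

at-AllPairs : ∀ {r} {R : Rel Vertex r} {S i j} → AllPairs R S →
              i < j → j < length S → R (at S i) (at S j)
at-AllPairs {S = x ∷ S} {zero}  {suc j} (Rx ∷ _) _         (s≤s j<n) = All.lookup Rx (at-∈ S j<n)
at-AllPairs {S = x ∷ S} {suc i} {suc j} (_ ∷ RS) (s≤s i<j) (s≤s j<n) = at-AllPairs RS i<j j<n

-- A vertex in no bag gets the number of bags.
firstBag : List VSet → Vertex → ℕ
firstBag []         x = 0
firstBag (b ∷ bags) x with _∈?_ _≟_ x b
... | yes _ = 0
... | no  _ = suc (firstBag bags x)

firstBag-∈ : ∀ bags i {x} → x ∈ lookup bags i →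
             ∃[ j ] toℕ j ≡ firstBag bags x × toℕ j ≤ toℕ i × x ∈ lookup bags j
firstBag-∈ (b ∷ bags) i {x} x∈ with _∈?_ _≟_ x b | i
... | yes x∈b | _     = zero , refl , z≤n , x∈b
... | no  x∉b | zero  = contradiction x∈ x∉b
... | no  _   | suc i = let j , eq , j≤i , x∈j = firstBag-∈ bags i x∈ in
                        suc j , cong suc eq , s≤s j≤i , x∈j

Late : Graph → ℕ → Pred Vertex _
Late G m x = Any (λ y → m < y × Adj G x y) (V G)

late? : ∀ G m → Decidable (Late G m)
late? G m x = Any.any? (λ y → (m <? y) ×-dec Adj? G x y) (V G)

-- For G on the vertices 1, …, n, the maximal size of a frontier is the vertex
-- separation number of this linear order.
frontier : Graph → ℕ → VSet
frontier G m = filter (late? G m) (range m)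

module _ (G : Graph) (m : ℕ) where

  frontier⁺ : ∀ {x} → x ∈ range m → Late G m x → x ∈ frontier G m
  frontier⁺ = ∈-filter⁺ (late? G m)

  frontier⁻ : ∀ {x} → x ∈ frontier G m → x ∈ range m × Late G m x
  frontier⁻ = ∈-filter⁻ (late? G m) {xs = range m}

width⇒∣bag∣≤ : ∀ {k} bags i → width bags ≤ k → ∣ lookup bags i ∣ ≤ suc k
width⇒∣bag∣≤ bags i width≤k = ≤-trans
  (All.lookup (All-map⁻ (xs≤max 0 (map ∣_∣ bags))) (∈-lookup i))
  (≤-trans (m≤n+m∸n _ 1) (s≤s width≤k))

-- A copy of `G` on the names used by the algorithm. `separation` concerns only those `m` after
-- which a next vertex exists, as the first bag of that vertex bounds the frontier.
record Numbering (k : ℕ) (G : Graph) : Set₁ where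
  field
    graph      : Graph
    iso        : graph ≅ G
    vertices   : V graph ≡ range ∣ V G ∣
    separation : ∀ {m} → m < ∣ V G ∣ → length (frontier graph m) ≤ k

-- The vertices are numbered in the order in which they enter the bags: the
-- m-th frontier and the next vertex z all lie in the first bag containing z.
number : ∀ {k G} → pw G ≤ k → Numbering k G
number {k} {G} (bags , pd , width≤k) = record
  { graph = graph
  ; iso = pullback-≅ label-inj label-surj
  ; vertices = cong range n≡
  ; separation = λ m<n → separation (subst (_ <_) (sym n≡) m<n)
  }
  where
  open IsPathDecomposition pd

  -- Vertices with the same first bag count as equal in this order; ties may be broken in any way.
  order = On.decTotalOrder ≤-decTotalOrder (firstBag bags)
  L₀ = deduplicate _≟_ (V G)
  L = Sort.sort order L₀
  L↭ : L ↭ L₀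
  L↭ = Sort.sort-↭ order L₀
  n = length L

  L! : Unique L
  L! = Unique-resp-↭ (setoid ℕ) (↭⇒↭ₛ (↭-sym L↭)) (deduplicate-! _≟_ (V G))

  L-sorted : AllPairs (λ x y → firstBag bags x ≤ firstBag bags y) L
  L-sorted = Sorted⇒AllPairs (DecTotalOrder.totalOrder order) (Sort.sort-↗ order L₀)

  L∼V : L ∼[ set ] V G
  L∼V = mk⇔ (∈-deduplicate⁻ _≟_ (V G) ∘ ∈-resp-↭ L↭)
            (∈-resp-↭ (↭-sym L↭) ∘ ∈-deduplicate⁺ _≟_)

  n≡ : n ≡ ∣ V G ∣
  n≡ = trans (sym (∣∣-Unique L!)) (∣∣-cong L∼V)

  label : ℕ → Vertex
  -- Names start at 1, list positions at 0.
  label x = at L (pred x)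

  label-∈ : ∀ {x} → x ∈ range n → label x ∈ V G
  label-∈ x∈ with _ , i<n , refl ← ∈-applyUpTo⁻ suc x∈ = to L∼V (at-∈ L i<n)

  label-inj : InjectiveOn (range n) label
  label-inj x∈ y∈ eq with i , i<n , refl ← ∈-applyUpTo⁻ suc x∈
                        | j , j<n , refl ← ∈-applyUpTo⁻ suc y∈ with <-cmp i j
  ... | tri< i<j _ _ = contradiction eq (at-AllPairs L! i<j j<n)
  ... | tri≈ _ i≡j _ = cong suc i≡j
  ... | tri> _ _ j<i = contradiction (sym eq) (at-AllPairs L! j<i i<n)

  label-surj : map label (range n) ∼[ set ] V G
  label-surj = mk⇔
    (λ y∈ → let _ , x∈ , y≡ = ∈-map⁻ label y∈ in subst (_∈ V G) (sym y≡) (label-∈ x∈))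
    (λ y∈ → let i , i<n , eq = ∈-at (from L∼V y∈) in
      subst (_∈ map label (range n)) eq (∈-map⁺ label (∈-applyUpTo⁺ suc i<n)))

  label-mono : ∀ {x y} → x ∈ range n → y ∈ range n → x ≤ y →
               firstBag bags (label x) ≤ firstBag bags (label y)
  label-mono x∈ y∈ x≤y with i , i<n , refl ← ∈-applyUpTo⁻ suc x∈
                          | j , j<n , refl ← ∈-applyUpTo⁻ suc y∈ with <-cmp i j
  ... | tri< i<j _ _  = at-AllPairs L-sorted i<j j<n
  ... | tri≈ _ refl _ = ≤-refl
  ... | tri> _ _ j<i  = contradiction x≤y (<⇒≱ (s<s j<i))

  graph = pullback label (range n) G

  separation : ∀ {m} → m < n → length (frontier graph m) ≤ k
  -- Counting `z` along with the frontier turns the bag size `suc k` into the bound `k`.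
  separation {m} m<n = ≤-pred (begin
    length S              ≡⟨ length-map label S ⟨
    length (map label S)  ≡⟨ ∣∣-Unique (map-Unique S-inj S!) ⟨
    ∣ map label S ∣       ≤⟨ ∣∣-mono S⊆bag ⟩
    ∣ lookup bags t ∣     ≤⟨ width⇒∣bag∣≤ bags t width≤k ⟩
    suc k                 ∎)
    where
    open ≤-Reasoning
    z = suc m
    S = z ∷ frontier graph m

    z∈ : z ∈ range n
    z∈ = ∈-applyUpTo⁺ suc m<n

    S! : Unique S
    S! = All.tabulate (λ x∈ z≡x → 1+n≰n (≤-trans (≤-reflexive z≡x) (∈-range⁻ (proj₁ (frontier⁻ graph m x∈)))))
       ∷ filter⁺ (late? graph m) (range-Unique m)

    S⊆range : S ⊆ range n
    S⊆range (here refl) = z∈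
    S⊆range (there x∈) with _ , late ← frontier⁻ graph m x∈ with _ , _ , _ , e ← find late = Adjˡ graph e

    S-inj : InjectiveOn S label
    S-inj x∈ y∈ = label-inj (S⊆range x∈) (S⊆range y∈)

    i₀ = vertices (label-∈ z∈)
    first-z = firstBag-∈ bags (proj₁ i₀) (proj₂ i₀)
    t = proj₁ first-z
    t≡ = proj₁ (proj₂ first-z)

    -- As `x` precedes `z`, it has entered by bag `t`. Its later neighbour `y` enters at `t` or
    -- after, so a bag `r` with both is not before `t`. The interval property puts `x` into bag `t`.
    frontier⊆bag : ∀ {x} → x ∈ frontier graph m → label x ∈ lookup bags t
    frontier⊆bag x∈ with x∈m , late ← frontier⁻ graph m x∈
                    with _ , _ , m<y , (e , x∈n , y∈n) ← find late
                    with r , x∈r , y∈r ← edges e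
                    with s , s≡ , _ , x∈s ← firstBag-∈ bags r x∈r
                       | s′ , s′≡ , s′≤r , _ ← firstBag-∈ bags r y∈r
      = interval s t r
          (begin toℕ s ≡⟨ s≡ ⟩ _ ≤⟨ label-mono x∈n z∈ (≤-trans (∈-range⁻ x∈m) (n≤1+n m)) ⟩
                 _ ≡⟨ t≡ ⟨ toℕ t ∎)
          (begin toℕ t ≡⟨ t≡ ⟩ _ ≤⟨ label-mono z∈ y∈n m<y ⟩
                 _ ≡⟨ s′≡ ⟨ toℕ s′ ≤⟨ s′≤r ⟩ toℕ r ∎)
          x∈s x∈r

    label-S⊆bag : ∀ {x} → x ∈ S → label x ∈ lookup bags t
    label-S⊆bag (here refl) = proj₂ (proj₂ (proj₂ first-z))
    label-S⊆bag (there x∈)  = frontier⊆bag x∈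

    S⊆bag : map label S ⊆ lookup bags t
    S⊆bag y∈ = let _ , x∈ , y≡ = ∈-map⁻ label y∈ in
      subst (_∈ lookup bags t) (sym y≡) (label-S⊆bag x∈)

-- The greedy smooth path-decomposition, with preparations.

∈-range-mono : ∀ {m n} → m ≤ n → range m ⊆ range n
∈-range-mono m≤n x∈ with _ , i<m , refl ← ∈-applyUpTo⁻ suc x∈ = ∈-applyUpTo⁺ suc (≤-trans i<m m≤n)

∈-range-suc⁻ : ∀ {n x} → x ∈ range (suc n) → x ∈ range n ⊎ x ≡ suc n
∈-range-suc⁻ {n} x∈ = ∈-∷ʳ⁻ (range n) (subst (_ ∈_) (sym (range-∷ʳ n)) x∈)

∷ʳ-cong : ∀ {S T} {x : Vertex} → S ∼[ set ] T → S ++ [ x ] ∼[ set ] T ++ [ x ]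
∷ʳ-cong {S} {T} S∼T = mk⇔ (∷ʳ-⊆ S (to S∼T)) (∷ʳ-⊆ T (from S∼T))
  where
  ∷ʳ-⊆ : ∀ S {T x} → S ⊆ T → S ++ [ x ] ⊆ T ++ [ x ]
  ∷ʳ-⊆ S {T} S⊆T x∈ with ∈-∷ʳ⁻ S x∈
  ... | inj₁ x∈S  = ∈-++⁺ˡ (S⊆T x∈S)
  ... | inj₂ refl = ∈-∷ʳ T

∖-cong : ∀ {S T w} → S ∼[ set ] T → S ∖ w ∼[ set ] T ∖ w
∖-cong {S} {T} S∼T = mk⇔
  (λ x∈ → let x∈S , x≢w = ∈-∖⁻ {S} x∈ in ∈-∖⁺ (to S∼T x∈S) x≢w)
  (λ x∈ → let x∈T , x≢w = ∈-∖⁻ {T} x∈ in ∈-∖⁺ (from S∼T x∈T) x≢w)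

∈-allEdges⁺ : ∀ {x y} S → x ≢ y → x ∈ S → y ∈ S → Joins (allEdges S) x y
∈-allEdges⁺ (z ∷ S) x≢y (here refl) (here refl) = contradiction refl x≢y
∈-allEdges⁺ (z ∷ S) x≢y (here refl) (there y∈)  = inj₁ (∈-++⁺ˡ (∈-map⁺ (z ,_) y∈))
∈-allEdges⁺ (z ∷ S) x≢y (there x∈)  (here refl) = inj₂ (∈-++⁺ˡ (∈-map⁺ (z ,_) x∈))
∈-allEdges⁺ (z ∷ S) x≢y (there x∈)  (there y∈)  =
  map-⊎ (∈-++⁺ʳ (map (z ,_) S)) (∈-++⁺ʳ (map (z ,_) S)) (∈-allEdges⁺ S x≢y x∈ y∈)

-- The sets `Y` and `E′` by which the algorithm follows a given graph arise by filtering with its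
-- adjacency, hence are among those tried.
filter-∈-subsets : ∀ {a p} {A : Set a} {P : Pred A p} (P? : Decidable P) xs →
                   filter P? xs ∈ subsets xs
filter-∈-subsets P? []       = here refl
filter-∈-subsets P? (x ∷ xs) with P? x
... | yes _ = ∈-++⁺ʳ (subsets xs) (∈-map⁺ (x ∷_) (filter-∈-subsets P? xs))
... | no  _ = ∈-++⁺ˡ (filter-∈-subsets P? xs)

Filtered-∈ : ∀ {a p} {A : Set a} {P : A → Set p} {x} {xs ys : List A} → Filtered P xs ys →
             x ∈ xs → P x → x ∈ ys
Filtered-∈ (keep _ f)  (here refl) _  = here refl
Filtered-∈ (drop ¬p _) (here refl) px = contradiction px ¬p
Filtered-∈ (keep _ f)  (there x∈)  px = there (Filtered-∈ f x∈ px)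
Filtered-∈ (drop _ f)  (there x∈)  px = Filtered-∈ f x∈ px

take-applyUpTo : ∀ {a} {A : Set a} (f : ℕ → A) {m n} → m ≤ n →
                 take m (applyUpTo f n) ≡ applyUpTo f m
take-applyUpTo f z≤n       = refl
take-applyUpTo f (s≤s m≤n) = cong (f 0 ∷_) (take-applyUpTo (f ∘ suc) m≤n)

-- Junk value 0 if S ⊆ T.
choose : VSet → VSet → Vertex
choose []      T = 0
choose (x ∷ S) T with _∈?_ _≟_ x T
... | yes _ = choose S T
... | no  _ = x

choose-spec : ∀ S T → (choose S T ∈ S × choose S T ∉ T) ⊎ S ⊆ T
choose-spec []      T = inj₂ λ ()
choose-spec (x ∷ S) T with _∈?_ _≟_ x T
... | no  x∉T = inj₁ (here refl , x∉T)
... | yes x∈T with choose-spec S T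
...   | inj₁ (c∈S , c∉T) = inj₁ (there c∈S , c∉T)
...   | inj₂ S⊆T         = inj₂ λ { (here refl) → x∈T ; (there y∈) → S⊆T y∈ }

-- Starting from the first k + 1 vertices, each later vertex replaces a vertex of
-- the current bag outside the current frontier, so the bag always contains the
-- frontier and every edge is met by the time its later end enters.
module Greedy (k d : ℕ) (G : Graph) (V≡ : V G ≡ range (d + suc k))
              (separation : ∀ {m} → m < d + suc k → length (frontier G m) ≤ k) where

  -- The number of vertices in the union of the bags up to bag j.
  size : ℕ → ℕ
  size j = j + suc k

  -- The recursion runs for all `j`; only for `j < d` is the chosen vertex known to lie in the bag
  -- and outside the frontier, by `out-spec`.
  bag : ℕ → VSet
  bag zero    = range (suc k)
  bag (suc j) = bag j ∖ choose (bag j) (frontier G (size j)) ++ [ suc (size j) ]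

  out : ℕ → Vertex
  out j = choose (bag j) (frontier G (size j))

  size-< : ∀ {j} → j < d → size j < d + suc k
  size-< = +-monoˡ-< (suc k)

  size-≤ : ∀ {j} → j ≤ d → size j ≤ d + suc k
  size-≤ = +-monoˡ-≤ (suc k)

  k≤size : ∀ j → k ≤ size j
  k≤size j = ≤-trans (n≤1+n k) (m≤n+m (suc k) j)

  bag-⊆-range : ∀ j → bag j ⊆ range (size j)
  bag-⊆-range zero    x∈ = x∈
  bag-⊆-range (suc j) x∈ with ∈-∷ʳ⁻ (bag j ∖ out j) x∈
  ... | inj₁ x∈′  = ∈-range-mono (n≤1+n _) (bag-⊆-range j (proj₁ (∈-∖⁻ {bag j} x∈′)))
  ... | inj₂ refl = ∈-applyUpTo⁺ suc ≤-refl

  suc∉range : ∀ {n} → suc n ∉ range n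
  suc∉range sn∈ = 1+n≰n (∈-range⁻ sn∈)

  bag-Unique : ∀ j → Unique (bag j)
  bag-Unique zero    = range-Unique (suc k)
  bag-Unique (suc j) = ++⁺ (filter⁺ _ (bag-Unique j)) ([] ∷ [])
    λ { (x∈ , here refl) → suc∉range (bag-⊆-range j (proj₁ (∈-∖⁻ {bag j} x∈))) }

  -- Proved together by recursion on `j`: a bag of k + 1 vertices does not fit into a frontier of at
  -- most k, so some vertex can leave, and the exchange restores the size.
  out-spec      : ∀ {j} → j < d → out j ∈ bag j × out j ∉ frontier G (size j)
  length-bag    : ∀ {j} → j ≤ d → length (bag j) ≡ suc k
  length-bag∖out : ∀ {j} → j < d → length (bag j ∖ out j) ≡ k

  out-spec {j} j<d with choose-spec (bag j) (frontier G (size j))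
  ... | inj₁ spec  = spec
  ... | inj₂ bag⊆f = contradiction
    (≤-trans (≤-reflexive (sym (length-bag (<⇒≤ j<d))))
      (≤-trans (Unique-⊆⇒length≤ (bag-Unique j) bag⊆f) (separation (size-< j<d))))
    1+n≰n

  length-bag {zero}  _   = length-applyUpTo suc (suc k)
  length-bag {suc j} j<d = trans (length-++ (bag j ∖ out j))
    (trans (+-comm (length (bag j ∖ out j)) 1) (cong suc (length-bag∖out j<d)))

  length-bag∖out {j} j<d = suc-injective
    (trans (length-∖-Unique (bag-Unique j) (proj₁ (out-spec j<d))) (length-bag (<⇒≤ j<d)))

  -- A vertex of the next frontier is either the entering one or already in the present frontier,
  -- and vertices of the present frontier are not dropped.
  frontier-⊆-bag : ∀ {j} → j ≤ d → frontier G (size j) ⊆ bag j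
  frontier-⊆-bag {zero}  _   x∈ = proj₁ (frontier⁻ G (suc k) x∈)
  frontier-⊆-bag {suc j} j<d x∈ with x∈r , late ← frontier⁻ G (suc (size j)) x∈
                                 with ∈-range-suc⁻ x∈r
  ... | inj₂ refl = ∈-∷ʳ (bag j ∖ out j)
  ... | inj₁ x∈r′ = ∈-++⁺ˡ (∈-∖⁺ (frontier-⊆-bag (<⇒≤ j<d) x∈f)
                      λ { refl → proj₂ (out-spec j<d) x∈f })
    where x∈f = frontier⁺ G (size j) x∈r′ (Any.map (λ (m<y , e) → <-trans (n<1+n _) m<y , e) late)

  bag-suc⁻ : ∀ {j x} → x ∈ bag (suc j) → x ∈ range (size j) → x ∈ bag j × x ≢ out j
  bag-suc⁻ {j} x∈ x∈r with ∈-∷ʳ⁻ (bag j ∖ out j) x∈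
  ... | inj₁ x∈′  = ∈-∖⁻ {bag j} x∈′
  ... | inj₂ refl = contradiction x∈r suc∉range

  -- Only fresh vertices enter, so a dropped vertex never returns. This yields the interval
  -- property.
  bag-back : ∀ {i j x} → i ≤ j → x ∈ bag j → x ∈ range (size i) → x ∈ bag i
  bag-back {i} {j} i≤j x∈j x∈r with m≤n⇒m<n∨m≡n i≤j
  ... | inj₂ refl = x∈j
  bag-back {i} {suc j} _ x∈j x∈r | inj₁ (s≤s i≤j) =
    bag-back i≤j (proj₁ (bag-suc⁻ x∈j (∈-range-mono (+-monoˡ-≤ (suc k) i≤j) x∈r))) x∈r

  range-⊆-bags : ∀ j {x} → x ∈ range (size j) → ∃[ i ] i ≤ j × x ∈ bag i
  range-⊆-bags zero    x∈ = zero , z≤n , x∈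
  range-⊆-bags (suc j) x∈ with ∈-range-suc⁻ x∈
  ... | inj₁ x∈′  = let i , i≤j , x∈i = range-⊆-bags j x∈′ in i , m≤n⇒m≤1+n i≤j , x∈i
  ... | inj₂ refl = suc j , ≤-refl , ∈-∷ʳ (bag j ∖ out j)

  -- The entering vertex is a later neighbour of `x`, which puts `x` into the frontier and protects
  -- it from being dropped.
  neighbour-∈-bag : ∀ {j x} → j < d → Adj G x (suc (size j)) → x ∈ range (size j) → x ∈ bag (suc j)
  neighbour-∈-bag {j} {x} j<d e x∈r =
    ∈-++⁺ˡ (∈-∖⁺ (frontier-⊆-bag (<⇒≤ j<d) x∈f) λ { refl → proj₂ (out-spec j<d) x∈f })
    where x∈f = frontier⁺ G (size j) x∈r (lose (Adjʳ G e) (≤-refl , e))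

  edge-⊆-bag : ∀ {j x y} → j ≤ d → Adj G x y → x ∈ range (size j) → y ∈ range (size j) →
               ∃[ i ] i ≤ j × x ∈ bag i × y ∈ bag i
  edge-⊆-bag {zero}  _   e x∈ y∈ = zero , z≤n , x∈ , y∈
  edge-⊆-bag {suc j} j<d e x∈ y∈ with ∈-range-suc⁻ x∈ | ∈-range-suc⁻ y∈
  ... | inj₁ x∈′  | inj₁ y∈′  = let i , i≤j , both = edge-⊆-bag (<⇒≤ j<d) e x∈′ y∈′ in
                                i , m≤n⇒m≤1+n i≤j , both
  ... | inj₁ x∈′  | inj₂ refl =
    suc j , ≤-refl , neighbour-∈-bag j<d e x∈′ , ∈-∷ʳ (bag j ∖ out j)
  ... | inj₂ refl | inj₁ y∈′  =
    suc j , ≤-refl , ∈-∷ʳ (bag j ∖ out j) , neighbour-∈-bag j<d (symm G e) y∈′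
  ... | inj₂ refl | inj₂ refl = contradiction e (irr G refl)

  V⇔range : V G ∼[ set ] range (size d)
  V⇔range = mk⇔ (subst (_ ∈_) V≡) (subst (_ ∈_) (sym V≡))

  bags : List VSet
  bags = applyUpTo bag (suc d)

  lookup-bags : ∀ i → lookup bags i ≡ bag (toℕ i)
  lookup-bags = lookup-applyUpTo bag (suc d)

  toℕ≤d : (i : Fin (length bags)) → toℕ i ≤ d
  toℕ≤d i = ≤-pred (subst (toℕ i <_) (length-applyUpTo bag (suc d)) (toℕ<n i))

  index : ∀ {j} → j ≤ d → ∃[ i ] toℕ {length bags} i ≡ j
  index {j} j≤d = fromℕ< j< , toℕ-fromℕ< j<
    where j< = subst (j <_) (sym (length-applyUpTo bag (suc d))) (s≤s j≤d)

  ∈-bag⇒∈-lookup : ∀ i {x} → x ∈ bag (toℕ i) → x ∈ lookup bags i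
  ∈-bag⇒∈-lookup i = subst (_ ∈_) (sym (lookup-bags i))

  ∈-lookup⇒∈-bag : ∀ i {x} → x ∈ lookup bags i → x ∈ bag (toℕ i)
  ∈-lookup⇒∈-bag i = subst (_ ∈_) (lookup-bags i)

  ∣bag∣ : ∀ {j} → j ≤ d → ∣ bag j ∣ ≡ suc k
  ∣bag∣ {j} j≤d = trans (∣∣-Unique (bag-Unique j)) (length-bag j≤d)

  bags-isPathDecomposition : IsPathDecomposition G bags
  bags-isPathDecomposition = record
    { bag-⊆    = λ i x∈ → from V⇔range
        (∈-range-mono (size-≤ (toℕ≤d i)) (bag-⊆-range (toℕ i) (∈-lookup⇒∈-bag i x∈)))
    ; vertices = vertices
    ; edges    = edges
    ; interval = λ h i j h≤i i≤j x∈h x∈j → ∈-bag⇒∈-lookup i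
        (bag-back i≤j (∈-lookup⇒∈-bag j x∈j)
          (∈-range-mono (+-monoˡ-≤ (suc k) h≤i) (bag-⊆-range (toℕ h) (∈-lookup⇒∈-bag h x∈h))))
    }
    where
    vertices : ∀ {x} → x ∈ V G → ∃[ i ] x ∈ lookup bags i
    vertices x∈ with _ , j≤d , x∈j ← range-⊆-bags d (to V⇔range x∈)
                with i , refl ← index j≤d = i , ∈-bag⇒∈-lookup i x∈j
    edges : ∀ {x y} → Adj G x y → ∃[ i ] x ∈ lookup bags i × y ∈ lookup bags i
    edges e with _ , j≤d , x∈j , y∈j ← edge-⊆-bag ≤-refl e (to V⇔range (Adjˡ G e)) (to V⇔range (Adjʳ G e))
            with i , refl ← index j≤d = i , ∈-bag⇒∈-lookup i x∈j , ∈-bag⇒∈-lookup i y∈j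

  bags-width : width bags ≡ k
  bags-width = ≤-antisym
    (width-≤ {bags = bags} (All-applyUpTo⁺ bag (suc d) (λ j<1+d → ≤-reflexive (∣bag∣ (≤-pred j<1+d)))))
    (∸-monoˡ-≤ 1 (v≤max⁺ 0 (map ∣_∣ bags) (inj₂ (here (≤-reflexive (sym (∣bag∣ z≤n)))))))

  bag∩bag : ∀ {j} → j < d → bag j ∩ bag (suc j) ∼[ set ] bag j ∖ out j
  bag∩bag {j} j<d = mk⇔
    (λ x∈ → let x∈j , x∈j+1 = ∈-filter⁻ (λ x → _∈?_ _≟_ x (bag (suc j))) {xs = bag j} x∈ in
      ∈-∖⁺ x∈j (proj₂ (bag-suc⁻ x∈j+1 (bag-⊆-range j x∈j))))
    (λ x∈ → ∈-filter⁺ (λ x → _∈?_ _≟_ x (bag (suc j))) (proj₁ (∈-∖⁻ {bag j} x∈)) (∈-++⁺ˡ x∈))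

  bags-isSmooth : IsSmooth k G bags
  bags-isSmooth = record
    { isPathDecomposition = bags-isPathDecomposition
    ; width≡k  = bags-width
    ; bag-size = λ i → trans (cong ∣_∣ (lookup-bags i)) (∣bag∣ (toℕ≤d i))
    ; meet     = meet
    }
    where
    meet : ∀ i j → toℕ j ≡ suc (toℕ i) → ∣ lookup bags i ∩ lookup bags j ∣ ≡ k
    meet i j j≡ rewrite lookup-bags i | lookup-bags j | j≡ = trans (∣∣-cong (bag∩bag i<d))
      (trans (∣∣-Unique (filter⁺ _ (bag-Unique (toℕ i)))) (length-bag∖out i<d))
      where i<d = subst (_≤ d) j≡ (toℕ≤d j)

  -- Following the pairs of the greedy decomposition through the algorithm.

  -- The edges of the graph associated with `bag j`: the bags up to `bag j` have union
  -- `range (size j)`, and edges inside `bag j` are left out.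
  Early : ℕ → Rel Vertex _
  Early j x y = Adj G x y × x ∈ range (size j) × y ∈ range (size j) × ¬ (x ∈ bag j × y ∈ bag j)

  Early-sym : ∀ {j x y} → Early j x y → Early j y x
  Early-sym (e , x∈ , y∈ , ¬both) = symm G e , y∈ , x∈ , λ (y∈j , x∈j) → ¬both (x∈j , y∈j)

  -- Stage j p: p is the j-th pair (counted from 0) contained in G through bags.
  record Stage (j : ℕ) (p : Pair) : Set where
    constructor stage
    field
      U∼ : proj₁ p ∼[ set ] bag j
      V∼ : V (proj₂ p) ∼[ set ] range (size j)
      E⇔ : ∀ {x y} → Adj (proj₂ p) x y ⇔ Early j x y

  prefix∼range : ∀ {j} → j ≤ d → concat (take (suc j) bags) ∼[ set ] range (size j)
  prefix∼range {j} j≤d = subst (λ bs → concat bs ∼[ set ] range (size j))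
    (sym (take-applyUpTo bag (s≤s j≤d))) (mk⇔ prefix⊆ range⊆)
    where
    prefix⊆ : concat (applyUpTo bag (suc j)) ⊆ range (size j)
    prefix⊆ x∈ with _ , x∈b , b∈ ← ∈-concat⁻′ (applyUpTo bag (suc j)) x∈
               with i , i<1+j , refl ← ∈-applyUpTo⁻ bag b∈
      = ∈-range-mono (+-monoˡ-≤ (suc k) (≤-pred i<1+j)) (bag-⊆-range i x∈b)
    range⊆ : range (size j) ⊆ concat (applyUpTo bag (suc j))
    range⊆ x∈ = let _ , i≤j , x∈i = range-⊆-bags j x∈ in ∈-concat⁺′ x∈i (∈-applyUpTo⁺ bag (s≤s i≤j))

  Stage⇒Contains : ∀ {j p} → j ≤ d → Stage j p → Contains k G p
  Stage⇒Contains {p = U , H} j≤d (stage U∼ V∼ E⇔) with i , refl ← index j≤d =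
    bags , bags-isSmooth , i ,
    mk⇔ (∈-bag⇒∈-lookup i ∘ to U∼) (from U∼ ∘ ∈-lookup⇒∈-bag i) ,
    record { V-≈ = mk⇔ V-to V-from ; Adj-≈ = mk⇔ Adj-to Adj-from }
    where
    prefix = concat (take (suc (toℕ i)) bags)
    module P {x} = Equivalence (prefix∼range j≤d {x})
    V-to : V H ⊆ V G ∩ prefix
    V-to x∈ = ∈-filter⁺ (λ x → _∈?_ _≟_ x prefix)
      (from V⇔range (∈-range-mono (size-≤ j≤d) (to V∼ x∈))) (P.from (to V∼ x∈))
    V-from : V G ∩ prefix ⊆ V H
    V-from x∈ = from V∼ (P.to (proj₂ (∈-filter⁻ (λ x → _∈?_ _≟_ x prefix) {xs = V G} x∈)))
    Adj-to : ∀ {x y} → Adj H x y → Adj (associated G bags i) x y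
    Adj-to e′ with e , x∈ , y∈ , ¬both ← to E⇔ e′ = (e , P.from x∈ , P.from y∈) ,
      λ (_ , x∈i , y∈i) → ¬both (∈-lookup⇒∈-bag i x∈i , ∈-lookup⇒∈-bag i y∈i)
    Adj-from : ∀ {x y} → Adj (associated G bags i) x y → Adj H x y
    Adj-from ((e , x∈ , y∈) , ¬both) = from E⇔ (e , P.to x∈ , P.to y∈ ,
      λ (x∈i , y∈i) → ¬both (e , ∈-bag⇒∈-lookup i x∈i , ∈-bag⇒∈-lookup i y∈i))

  Stage⇒Embedding : ∀ {j p} → j ≤ d → Stage j p → Embedding (proj₂ p) G
  Stage⇒Embedding j≤d (stage _ V∼ E⇔) = Subgraph⇒Embedding record
    { V-⊆   = from V⇔range ∘ ∈-range-mono (size-≤ j≤d) ∘ to V∼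
    ; Adj-⊆ = proj₁ ∘ to E⇔
    }

  -- The edges that become early are those from the dropped vertex to the rest of its bag, which
  -- dictates `Y`. Edges from older vertices to the entering one lie inside the new bag and wait.
  Stage-step : ∀ {j U H v} → j < d → Stage j (U , H) → v ≡ suc (size j) →
               let w = out j ; Y = filter (Adj? G w) (U ∖ w) in
               Stage (suc j) (U ∖ w ++ [ v ] , H +v v +E map (w ,_) Y)
  Stage-step {j} {U} {H} {v} j<d (stage U∼ V∼ E⇔) refl =
    stage (∷ʳ-cong (∖-cong U∼)) V′∼ (mk⇔ Adj-to Adj-from)
    where
    w = out j
    Y = filter (Adj? G w) (U ∖ w)
    H′ = H +v v +E map (w ,_) Y

    V′∼ : V H ++ [ v ] ∼[ set ] range (size (suc j))
    V′∼ = subst (V H ++ [ v ] ∼[ set ]_) (range-∷ʳ (size j)) (∷ʳ-cong V∼)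

    up : range (size j) ⊆ range (size (suc j))
    up = ∈-range-mono (n≤1+n _)

    w∈range : w ∈ range (size j)
    w∈range = bag-⊆-range j (proj₁ (out-spec j<d))

    new-edge : ∀ {y} → y ∈ Y → Early (suc j) w y
    new-edge y∈Y with y∈U∖w , e ← ∈-filter⁻ (Adj? G w) {xs = U ∖ w} y∈Y =
      e , up w∈range , up (bag-⊆-range j (to U∼ (proj₁ (∈-∖⁻ {U} y∈U∖w)))) ,
      λ (w∈ , _) → proj₂ (bag-suc⁻ {j} w∈ w∈range) refl

    Joins-to : ∀ {x y} → (x , y) ∈ map (w ,_) Y → Early (suc j) x y
    Joins-to xy with _ , y∈Y , refl ← ∈-map⁻ (w ,_) xy = new-edge y∈Y

    Adj-to : ∀ {x y} → Adj H′ x y → Early (suc j) x y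
    Adj-to (inj₂ (inj₁ xy , _)) = Joins-to xy
    Adj-to (inj₂ (inj₂ yx , _)) = Early-sym {suc j} (Joins-to yx)
    Adj-to (inj₁ e′) with e , x∈ , y∈ , ¬both ← to E⇔ e′ = e , up x∈ , up y∈ ,
      λ (x∈′ , y∈′) → ¬both (proj₁ (bag-suc⁻ {j} x∈′ x∈) , proj₁ (bag-suc⁻ {j} y∈′ y∈))

    w-edge : ∀ {y} → Adj G w y → y ∈ bag j → (w , y) ∈ map (w ,_) Y
    w-edge e y∈j = ∈-map⁺ (w ,_)
      (∈-filter⁺ (Adj? G w) (∈-∖⁺ (from U∼ y∈j) (λ { refl → irr G refl e })) e)

    -- An edge whose ends are old either already occurs in H or has both ends in
    -- bag j; in the latter case it disappears from the bag only if it meets w.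
    old-edge : ∀ {x y} → Adj G x y → x ∈ range (size j) → y ∈ range (size j) →
               ¬ (x ∈ bag (suc j) × y ∈ bag (suc j)) → Adj H x y ⊎ Joins (map (w ,_) Y) x y
    old-edge {x} {y} e x∈ y∈ ¬both with _∈?_ _≟_ x (bag j) ×-dec _∈?_ _≟_ y (bag j)
    ... | no  ¬both′ = inj₁ (from E⇔ (e , x∈ , y∈ , ¬both′))
    ... | yes (x∈j , y∈j) with x ≟ w | y ≟ w
    ...   | yes refl | _        = inj₂ (inj₁ (w-edge e y∈j))
    ...   | no _     | yes refl = inj₂ (inj₂ (w-edge (symm G e) x∈j))
    ...   | no x≢w   | no y≢w   =
      contradiction (∈-++⁺ˡ (∈-∖⁺ x∈j x≢w) , ∈-++⁺ˡ (∈-∖⁺ y∈j y≢w)) ¬both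

    Adj-from : ∀ {x y} → Early (suc j) x y → Adj H′ x y
    Adj-from (e , x∈ , y∈ , ¬both) with ∈-range-suc⁻ x∈ | ∈-range-suc⁻ y∈
    ... | inj₁ x∈′  | inj₂ refl =
      contradiction (neighbour-∈-bag j<d e x∈′ , ∈-∷ʳ (bag j ∖ w)) ¬both
    ... | inj₂ refl | inj₁ y∈′  =
      contradiction (∈-∷ʳ (bag j ∖ w) , neighbour-∈-bag j<d (symm G e) y∈′) ¬both
    ... | inj₂ refl | inj₂ refl = contradiction e (irr G refl)
    ... | inj₁ x∈′  | inj₁ y∈′  with old-edge e x∈′ y∈′ ¬both
    ...   | inj₁ e′ = inj₁ e′
    ...   | inj₂ xy = inj₂ (xy , (λ x≡y → irr G x≡y e) , from V′∼ x∈ , from V′∼ y∈)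

  -- At the last stage `H` lacks only the edges of `G` inside the final bag, and these form one of
  -- the sets tried in step (a).
  Stage-last : ∀ {U H} → Stage d (U , H) → ∃[ E ] E ∈ subsets (allEdges U) × (H +E E) ≈ G
  Stage-last {U} {H} (stage U∼ V∼ E⇔) = E , filter-∈-subsets inG? (allEdges U) , record
    { V-≈   = mk⇔ (from V⇔range ∘ to V∼) (from V∼ ∘ to V⇔range)
    ; Adj-≈ = mk⇔ Adj-to Adj-from
    }
    where
    inG? : Decidable (λ (x , y) → Adj G x y)
    inG? (x , y) = Adj? G x y
    E = filter inG? (allEdges U)
    Adj-to : ∀ {x y} → Adj (H +E E) x y → Adj G x y
    Adj-to (inj₁ e)             = proj₁ (to E⇔ e)
    Adj-to (inj₂ (inj₁ xy , _)) = proj₂ (∈-filter⁻ inG? {xs = allEdges U} xy)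
    Adj-to (inj₂ (inj₂ yx , _)) = symm G (proj₂ (∈-filter⁻ inG? {xs = allEdges U} yx))
    Adj-from : ∀ {x y} → Adj G x y → Adj (H +E E) x y
    Adj-from {x} {y} e with _∈?_ _≟_ x (bag d) ×-dec _∈?_ _≟_ y (bag d)
    ... | no  ¬both     = inj₁ (from E⇔ (e , to V⇔range (Adjˡ G e) , to V⇔range (Adjʳ G e) , ¬both))
    ... | yes (x∈ , y∈) = inj₂
      ( map-⊎ (λ xy → ∈-filter⁺ inG? xy e) (λ yx → ∈-filter⁺ inG? yx (symm G e))
          (∈-allEdges⁺ U (λ x≡y → irr G x≡y e) (from U∼ x∈) (from U∼ y∈))
      , (λ x≡y → irr G x≡y e)
      , from V∼ (to V⇔range (Adjˡ G e)) , from V∼ (to V⇔range (Adjʳ G e)))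

-- Completeness of the answer NONE.

module Completeness {ℓ} (𝒢 : GraphClass ℓ) (𝒰 : List Graph) (k : ℕ) where
  open TestUnavoidableStructures 𝒢 𝒰 k
  open Soundness 𝒢 𝒰 k

  ∈-candidates⁺ : ∀ p {w Y} → w ∈ proj₁ p → Y ∈ subsets (proj₁ p ∖ w) → extend p w Y ∈ candidates p
  ∈-candidates⁺ p@(U , _) w∈U Y∈ =
    ∈-concatMap⁺ (λ w → map (extend p w) (subsets (U ∖ w))) (lose w∈U (∈-map⁺ (extend p _) Y∈))

  module _ (d : ℕ) (G : Graph) (V≡ : V G ≡ range (d + suc k))
           (separation : ∀ {m} → m < d + suc k → length (frontier G m) ≤ k) where
    open Greedy k d G V≡ separation

    initial-Stage : Stage 0 initial
    initial-Stage = stage initial∼ initial∼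
      (mk⇔ (λ ()) (λ (_ , x∈ , y∈ , ¬both) → ¬both (x∈ , y∈)))
      where
      initial∼ : proj₁ initial ∼[ set ] range (suc k)
      initial∼ = mk⇔ (subst (_ ∈_) initial-names) (subst (_ ∈_) (sym initial-names))

    -- Induction on the run. A pair behind the head stays queued. At the head, the last stage
    -- contradicts the failed return test; an earlier stage has a successor that is admissible, as
    -- `G` contains it and its graph embeds into `G`.
    run-complete : ∀ {Q j p} → Counterexample G → Run Q nothing → j ≤ d → Stage j p → p ∈ Q → ⊥
    run-complete ce (next {Q = Q} _ _ _ run) j≤d st (there p∈) =
      run-complete ce run j≤d st (∈-++⁺ˡ p∈)
    run-complete {j = j} {p = U , H} ce@(G∈𝒢 , G∉super) (next {Q = Q} none-here ps↭ filtered run) j≤d st (here refl)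
      with m≤n⇒m<n∨m≡n j≤d
    ... | inj₂ refl = let _ , E∈ , H+E≈G = Stage-last st in
      none-here E∈ (closed 𝒢 (≅-sym (≈⇒≅ H+E≈G)) G∈𝒢 ,
                    G∉super ∘ super-Embedding (≅⇒Embedding (≈⇒≅ H+E≈G)))
    ... | inj₁ j<d = run-complete ce run j<d st′
      (∈-++⁺ʳ Q (Filtered-∈ filtered (∈-resp-↭ (↭-sym ps↭) q∈)
        (G∉super ∘ super-Embedding (Stage⇒Embedding j<d st′) , G , G∈𝒢 , Stage⇒Contains j<d st′)))
      where
      open Stage st
      w = out j
      Y = filter (Adj? G w) (U ∖ w)
      st′ : Stage (suc j) (extend (U , H) w Y)
      st′ = Stage-step j<d st (v-fresh (k≤size j) (sym (∣∣-cong V∼)))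
      q∈ : extend (U , H) w Y ∈ candidates (U , H)
      q∈ = ∈-candidates⁺ (U , H) (from U∼ (proj₁ (out-spec j<d))) (filter-∈-subsets (Adj? G w) (U ∖ w))

    numbered-complete : Returns nothing → Member 𝒢 G → ¬ ¬ super 𝒰 G
    -- The greedy decomposition makes `G` contain the initial pair, so goodness applies to `G`
    -- itself.
    numbered-complete (_ , removed good , _) G∈𝒢 G∉super = G∉super
      (good G (G∈𝒢 , bags , bags-isPathDecomposition , ≤-reflexive bags-width)
        (Stage⇒Contains z≤n initial-Stage))
    numbered-complete (_ , kept _ , run) G∈𝒢 G∉super =
      run-complete (G∈𝒢 , G∉super) run z≤n initial-Stage (here refl)

  complete : Returns nothing → ∀ {G} → (𝒢 ^ k) G → suc k ≤ ∣ V G ∣ → super 𝒰 G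
  complete returns {G} (G∈𝒢 , pw≤k) k<n = decidable-stable (super? 𝒰 G) λ G∉super →
    -- All vertices but the first k + 1 enter one at a time; `k<n` makes the subtraction exact.
    numbered-complete (∣ V G ∣ ∸ suc k) graph
      (trans vertices (cong range n≡)) (λ {m} m<n → separation (subst (m <_) (sym n≡) m<n))
      returns (closed 𝒢 (≅-sym iso) G∈𝒢) (G∉super ∘ super-Embedding (≅⇒Embedding iso))
    where
    open Numbering (number pw≤k)
    n≡ : ∣ V G ∣ ≡ ∣ V G ∣ ∸ suc k + suc k
    n≡ = sym (m∸n+n≡m k<n)

theorem9 : ∀ {ℓ : Level} (k : ℕ) (𝒢 : GraphClass ℓ) (member? : Decidable (Member 𝒢)) →
    (∀ {G} → Member 𝒢 G → suc k ≤ ∣ V G ∣) →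
    (𝒰 : List Graph) → All NonEmpty 𝒰 →
    let open TestUnavoidableStructures 𝒢 𝒰 k in
    (∀ G → Returns (just G) → (𝒢 ^ k) G × ¬ super 𝒰 G) ×
    (Returns nothing → ∀ G → (𝒢 ^ k) G → super 𝒰 G)
theorem9 k 𝒢 _ k<∣V∣ 𝒰 _ =
  (λ _ → Soundness.sound 𝒢 𝒰 k) ,
  (λ returns _ G∈ → Completeness.complete 𝒢 𝒰 k returns G∈ (k<∣V∣ (proj₁ G∈)))
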